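{- Let $n\geq 4$. Then the augmented cube $AQ_n$ is fractional strongly maximally matched and fractional strongly super matched.
   Context: $G-F$ deletes the vertices and edges of $F\subseteq V(G)\cup E(G)$; $\delta(G)$ is the minimum degree. A fractional perfect matching of $G$ is $f:E(G)\to[0,1]$ with $\sum_{e\ni v}f(e)=1$ for all vertices $v$. $F$ is a fractional strong matching preclusion (FSMP) set if $G-F$ has no fractional perfect matching; $fsmp(G)$ is the minimum size of an FSMP set; an FSMP set $F$ is optimal if $|F|=fsmp(G)$. $G$ is fractional strongly maximally matched if $fsmp(G)=\delta(G)$, and fractional strongly super matched if moreover $G-F$ has an isolated vertex for every optimal FSMP set $F$. The augmented cube $AQ_n$: vertices are $n$-bit binary strings; $AQ_1\cong K_2$; for $n\geq2$, take copies $AQ^0_{n-1},AQ^1_{n-1}$ of $AQ_{n-1}$ (vertices prefixed by $0$ and $1$) and join $0u_1\cdots u_{n-1}$ to $1v_1\cdots v_{n-1}$ iff $u_i=v_i$ for all $i$ or $u_i\neq v_i$ for all $i$. $AQ_n$ is $(2n-1)$-regular.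
   Formalization: Fractional perfect matchings are taken with rational values in [0,1] instead of real values; for finite graphs a real one exists if and only if a rational one does. -}

module Defs where

open import Data.Bool using (Bool; true; false; not)
open import Data.Bool.Properties using () renaming (_≟_ to _≟B_)
open import Data.Nat using (ℕ; zero; suc; _⊓_)
open import Data.Vec using (Vec; []; _∷_)
import Data.Vec as Vec
open import Data.Vec.Properties using (≡-dec)
open import Data.List using (List; []; _∷_; _++_; map; length; filter; foldr)
open import Data.List.Membership.Propositional using (_∈_)
open import Data.List.Membership.Propositional.Properties
  using (∈-++⁺ˡ; ∈-++⁺ʳ; ∈-map⁺; ∈-map⁻)
open import Data.List.Relation.Unary.Unique.Propositional using (Unique)
open import Data.List.Relation.Unary.Unique.Propositional.Properties
  using () renaming (map⁺ to U-map⁺; ++⁺ to U-++⁺)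
open import Data.List.Relation.Unary.All using (All)
open import Data.List.Relation.Unary.AllPairs using (AllPairs)
open import Data.List.Relation.Unary.Any using (here)
open import Data.Product using (Σ; _×_; _,_; ∃)
open import Data.Sum using (_⊎_; inj₁; inj₂)
open import Data.Empty using (⊥)
open import Data.Unit using (⊤)
open import Data.Rational using (ℚ; 0ℚ; 1ℚ; _+_; _≤_)
open import Relation.Nullary using (¬_; Dec; yes; no)
open import Relation.Nullary.Decidable using (_⊎-dec_)
open import Relation.Binary.Definitions using (DecidableEquality)
open import Relation.Binary.PropositionalEquality
  using (_≡_; refl; sym; trans; cong)

record Graph : Set₁ where
  field
    V       : Set
    _≟V_    : DecidableEquality V
    verts   : List V
    verts-complete : ∀ v → v ∈ verts
    verts-unique   : Unique verts
    Adj     : V → V → Set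
    adj?    : ∀ u v → Dec (Adj u v)
    adj-sym : ∀ {u v} → Adj u v → Adj v u
    adj-irrefl : ∀ {v} → ¬ Adj v v

module _ (G : Graph) where
  open Graph G

  degree : V → ℕ
  degree v = length (filter (adj? v) verts)

  minList : List ℕ → ℕ
  minList []       = 0
  minList (x ∷ xs) = foldr _⊓_ x xs

  δ : ℕ
  δ = minList (map degree verts)

  -- Elements of V(G) ∪ E(G): a vertex, or an edge given by its two ends.
  Elem : Set
  Elem = V ⊎ (V × V)

  SameElem : Elem → Elem → Set
  SameElem (inj₁ u) (inj₁ v) = u ≡ v
  SameElem (inj₁ _) (inj₂ _) = ⊥
  SameElem (inj₂ _) (inj₁ _) = ⊥
  SameElem (inj₂ (a , b)) (inj₂ (c , d)) = (a ≡ c × b ≡ d) ⊎ (a ≡ d × b ≡ c)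

  ValidElem : Elem → Set
  ValidElem (inj₁ _)       = ⊤
  ValidElem (inj₂ (u , v)) = Adj u v

  -- F ⊆ V(G) ∪ E(G), given as a duplicate-free list; |F| = length F
  IsFaultSet : List Elem → Set
  IsFaultSet F = All ValidElem F × AllPairs (λ x y → ¬ SameElem x y) F

  module _ (F : List Elem) where
    Alive : V → Set
    Alive v = ¬ (inj₁ v ∈ F)

    LiveEdge : V → V → Set
    LiveEdge u v = Adj u v × Alive u × Alive v
                   × ¬ (inj₂ (u , v) ∈ F) × ¬ (inj₂ (v , u) ∈ F)

    sumOver : (V → ℚ) → ℚ
    sumOver g = foldr (λ v acc → g v + acc) 0ℚ verts

    -- a fractional perfect matching of G - F; f(u,v) is the value on the
    -- edge uv (symmetric), extended by 0 to non-edges of G - F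
    IsFracPerfectMatching : (V → V → ℚ) → Set
    IsFracPerfectMatching f =
        (∀ u v → f u v ≡ f v u)
      × (∀ u v → ¬ LiveEdge u v → f u v ≡ 0ℚ)
      × (∀ u v → LiveEdge u v → 0ℚ ≤ f u v × f u v ≤ 1ℚ)
      × (∀ u → Alive u → sumOver (f u) ≡ 1ℚ)

    HasFracPerfectMatching : Set
    HasFracPerfectMatching = Σ (V → V → ℚ) IsFracPerfectMatching

    HasIsolatedVertex : Set
    HasIsolatedVertex = Σ V (λ v → Alive v × (∀ u → ¬ LiveEdge v u))

  IsFSMPSet : List Elem → Set
  IsFSMPSet F = IsFaultSet F × ¬ HasFracPerfectMatching F

  FsmpIs : ℕ → Set
  FsmpIs k = (Σ (List Elem) λ F → IsFSMPSet F × length F ≡ k)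
           × (∀ F → IsFSMPSet F → k Data.Nat.≤ length F)

  FracStronglyMaximallyMatched : Set
  FracStronglyMaximallyMatched = FsmpIs δ

  FracStronglySuperMatched : Set
  FracStronglySuperMatched =
      FracStronglyMaximallyMatched
    × (∀ F → IsFSMPSet F → length F ≡ δ → HasIsolatedVertex F)

allVecs : (n : ℕ) → List (Vec Bool n)
allVecs zero    = [] ∷ []
allVecs (suc n) = map (false ∷_) (allVecs n) ++ map (true ∷_) (allVecs n)

allVecs-complete : ∀ n (v : Vec Bool n) → v ∈ allVecs n
allVecs-complete zero [] = here refl
allVecs-complete (suc n) (false ∷ v) = ∈-++⁺ˡ (∈-map⁺ (false ∷_) (allVecs-complete n v))
allVecs-complete (suc n) (true ∷ v) =
  ∈-++⁺ʳ (map (false ∷_) (allVecs n)) (∈-map⁺ (true ∷_) (allVecs-complete n v))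

private
  ∷-inj : ∀ {n} {b : Bool} {x y : Vec Bool n} → b ∷ x ≡ b ∷ y → x ≡ y
  ∷-inj refl = refl

  disj : ∀ n {v : Vec Bool (suc n)} →
         ¬ (v ∈ map (false ∷_) (allVecs n) × v ∈ map (true ∷_) (allVecs n))
  disj n (p , q) with ∈-map⁻ (false ∷_) p | ∈-map⁻ (true ∷_) q
  ... | (_ , _ , refl) | (_ , _ , ())

allVecs-unique : ∀ n → Unique (allVecs n)
allVecs-unique zero = All.[] AP.∷ AP.[]
  where import Data.List.Relation.Unary.AllPairs as AP
        import Data.List.Relation.Unary.All as All
allVecs-unique (suc n) =
  U-++⁺ (U-map⁺ ∷-inj (allVecs-unique n)) (U-map⁺ ∷-inj (allVecs-unique n)) (disj n)

complement : ∀ {n} → Vec Bool n → Vec Bool n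
complement = Vec.map not

AQAdj : ∀ {n} → Vec Bool n → Vec Bool n → Set
AQAdj []          []          = ⊥
AQAdj (false ∷ u) (false ∷ v) = AQAdj u v
AQAdj (true ∷ u)  (true ∷ v)  = AQAdj u v
AQAdj (false ∷ u) (true ∷ v)  = u ≡ v ⊎ u ≡ complement v
AQAdj (true ∷ u)  (false ∷ v) = u ≡ v ⊎ u ≡ complement v

private
  compl-invol : ∀ {n} (v : Vec Bool n) → complement (complement v) ≡ v
  compl-invol [] = refl
  compl-invol (true ∷ v)  = cong (true ∷_) (compl-invol v)
  compl-invol (false ∷ v) = cong (false ∷_) (compl-invol v)

  cross-sym : ∀ {n} {u v : Vec Bool n} → u ≡ v ⊎ u ≡ complement v → v ≡ u ⊎ v ≡ complement u
  cross-sym (inj₁ e) = inj₁ (sym e)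
  cross-sym {v = v} (inj₂ refl) = inj₂ (sym (compl-invol v))

AQAdj? : ∀ {n} (u v : Vec Bool n) → Dec (AQAdj u v)
AQAdj? [] [] = no (λ ())
AQAdj? (false ∷ u) (false ∷ v) = AQAdj? u v
AQAdj? (true ∷ u)  (true ∷ v)  = AQAdj? u v
AQAdj? (false ∷ u) (true ∷ v)  = ≡-dec _≟B_ u v ⊎-dec ≡-dec _≟B_ u (complement v)
AQAdj? (true ∷ u)  (false ∷ v) = ≡-dec _≟B_ u v ⊎-dec ≡-dec _≟B_ u (complement v)

AQAdj-sym : ∀ {n} {u v : Vec Bool n} → AQAdj u v → AQAdj v u
AQAdj-sym {u = []} {[]} ()
AQAdj-sym {u = false ∷ u} {false ∷ v} a = AQAdj-sym {u = u} {v} a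
AQAdj-sym {u = true ∷ u}  {true ∷ v}  a = AQAdj-sym {u = u} {v} a
AQAdj-sym {u = false ∷ u} {true ∷ v}  a = cross-sym a
AQAdj-sym {u = true ∷ u}  {false ∷ v} a = cross-sym a

AQAdj-irrefl : ∀ {n} {v : Vec Bool n} → ¬ AQAdj v v
AQAdj-irrefl {v = []} ()
AQAdj-irrefl {v = false ∷ v} a = AQAdj-irrefl {v = v} a
AQAdj-irrefl {v = true ∷ v}  a = AQAdj-irrefl {v = v} a

AQ : ℕ → Graph
AQ n = record
  { V = Vec Bool n
  ; _≟V_ = ≡-dec _≟B_
  ; verts = allVecs n
  ; verts-complete = allVecs-complete n
  ; verts-unique = allVecs-unique n
  ; Adj = AQAdj
  ; adj? = AQAdj?
  ; adj-sym = λ {u} {v} a → AQAdj-sym {u = u} {v} a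
  ; adj-irrefl = λ {v} a → AQAdj-irrefl {v = v} a
  }

{-# OPTIONS --safe #-}
module Submission where

-- A permutation σ of the vertices of G - F along live edges gives a fractional perfect matching
-- with value ½ on each arc u → σ u. If there is none, Hall's theorem gives a set T, independent
-- in G - F, with fewer than |T| neighbours there. Every vertex of the boundary ∂T in G that is not
-- such a neighbour, and every edge inside T, requires a fault of its own, so that
-- |F| > |∂T| + e(T) - |T|. The right-hand side is superadditive over the two halves of AQₙ, and
-- if T lies in one half, ∂T also contains T and its antipodes copied to the other half. By
-- induction from n = 4, checked exhaustively, it is at least 2n - 2 for T ≠ ∅ and at least 2n - 1
-- for |T| ≥ 2. Hence |F| ≥ 2n - 1, and equality forces |T| = 1, an isolated vertex.

open import Defs
open import Data.Nat using (ℕ; _≤_)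
open import Data.Product using (_×_)

open import Algebra.Bundles using (CommutativeMonoid)
import Algebra.Properties.CommutativeSemigroup as CommutativeSemigroup
open import Data.Bool using (Bool; true; false; not; _∧_; _∨_; if_then_else_)
import Data.Bool as Bool
import Data.Bool.Properties as Bool
open import Data.List using (List; []; _∷_; _++_; map; length; filter; foldr; concatMap; deduplicate)
open import Data.List.Membership.Propositional using (_∈_; _∉_; find; lose)
open import Data.List.Membership.Propositional.Properties
import Data.List.Membership.DecPropositional as DecMembership
open import Data.List.Properties using (length-++; length-map; filter-++)
open import Data.List.Relation.Binary.Subset.Propositional using (_⊆_)
open import Data.List.Relation.Unary.All as All using (All; []; _∷_)
import Data.List.Relation.Unary.All.Properties as All
open import Data.List.Relation.Unary.AllPairs as AllPairs using (AllPairs; []; _∷_)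
import Data.List.Relation.Unary.AllPairs.Properties as AllPairs
open import Data.List.Relation.Unary.Any using (here; there)
open import Data.List.Relation.Unary.Unique.Propositional using (Unique)
import Data.List.Relation.Unary.Unique.Propositional.Properties as Unique
import Data.List.Relation.Unary.Unique.DecPropositional.Properties as UniqueDec
open import Data.Nat using (zero; suc; _+_; _<_; z≤n; s≤s; _≤?_; _≟_; _≤ᵇ_; _<ᵇ_; _⊓_)
open import Data.Nat.Properties
open import Data.Nat.Solver using (module +-*-Solver)
open import Data.Product using (Σ; _,_; ∃; proj₁; proj₂; uncurry)
import Data.Product.Properties as Product
open import Data.Rational using (ℚ; 0ℚ; 1ℚ; ½)
import Data.Rational as ℚ
import Data.Rational.Properties as ℚ
open import Data.Sum using (_⊎_; inj₁; inj₂)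
import Data.Sum.Properties as Sum
open import Data.Vec using (Vec; []; _∷_; replicate)
open import Data.Vec.Properties using (∷-injectiveʳ; map-id; map-cong; map-∘)
open import Function using (_∘_; Equivalence)
open import Relation.Binary.Definitions using (DecidableEquality)
open import Relation.Binary.PropositionalEquality
open import Relation.Nullary using (¬_; Dec; yes; no; does; contradiction; ¬?; _×-dec_)
open import Relation.Nullary.Decidable using (from-yes; dec-true)

-- Pigeonhole and Hall's theorem

∈-remove : ∀ {A : Set} {y : A} {ys} → y ∈ ys →
  ∃ λ zs → length ys ≡ suc (length zs) × (∀ {z} → z ∈ ys → z ≢ y → z ∈ zs)
∈-remove {ys = y ∷ ys} (here refl) = ys , refl , λ
  { (here p) z≢y → contradiction p z≢y ; (there p) _ → p }
∈-remove {ys = x ∷ ys} (there p) =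
  let zs , len , keep = ∈-remove p in
  x ∷ zs , cong suc len , λ { (here q) _ → here q ; (there q) z≢y → there (keep q z≢y) }

-- Stated for a relation under which no `y` serves two entries of `xs`, so that holes can be chosen
-- one at a time: once the hole of the first entry is removed from `ys`, no later entry loses its
-- own.
pigeonhole : ∀ {A B : Set} (S : A → B → Set) {xs ys} →
  AllPairs (λ x x′ → ∀ y → S x y → ¬ S x′ y) xs →
  (∀ {x} → x ∈ xs → ∃ λ y → y ∈ ys × S x y) → length xs ≤ length ys
pigeonhole S [] hole = z≤n
pigeonhole S {ys = ys} (x# ∷ xs#) hole =
  let y , y∈ys , sxy = hole (here refl)
      zs , len , keep = ∈-remove y∈ys
  in subst (_ ≤_) (sym len) (s≤s (pigeonhole S xs# λ x′∈ →
       let y′ , y′∈ys , sx′y′ = hole (there x′∈)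
       in y′ , keep y′∈ys (λ e → All.lookup x# x′∈ y sxy (subst (S _) e sx′y′)) , sx′y′))

Unique-⊆⇒length≤ : ∀ {A : Set} {xs ys : List A} → Unique xs → xs ⊆ ys → length xs ≤ length ys
Unique-⊆⇒length≤ xs! xs⊆ys = pigeonhole _≡_ (AllPairs.map (λ { x≢ y refl e → x≢ (sym e) }) xs!)
  (λ x∈ → _ , xs⊆ys x∈ , refl)

map-unique : ∀ {A B : Set} (f : A → B) {xs} →
  (∀ {x y} → x ∈ xs → y ∈ xs → f x ≡ f y → x ≡ y) → Unique xs → Unique (map f xs)
map-unique f inj []         = []
map-unique f inj (x# ∷ xs!) =
  All.tabulate (λ y∈ e → let z , z∈ , y≡ = ∈-map⁻ f y∈ in
    All.lookup x# z∈ (inj (here refl) (there z∈) (trans e y≡)))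
  ∷ map-unique f (λ p q → inj (there p) (there q)) xs!

module _ {A : Set} (_≟_ : DecidableEquality A) where
  open DecMembership _≟_ using (_∈?_)

  -- An element of `ys` missing from `xs` could be added to `xs`, giving a duplicate-free list
  -- inside `ys` that is longer than `ys`.
  Unique-tight : ∀ {xs ys} → Unique xs → xs ⊆ ys → length ys ≤ length xs → ys ⊆ xs
  Unique-tight {xs} {ys} xs! xs⊆ys len {y} y∈ys with y ∈? xs
  ... | yes y∈xs = y∈xs
  ... | no  y∉xs = contradiction len (<⇒≱ (Unique-⊆⇒length≤ (All.¬Any⇒All¬ _ y∉xs ∷ xs!)
          λ { (here refl) → y∈ys ; (there p) → xs⊆ys p }))

search : ∀ {A : Set} {P Q : A → Set} xs → (∀ x → P x ⊎ Q x) → ∃ P ⊎ (∀ {x} → x ∈ xs → Q x)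
search []       f = inj₂ λ ()
search (x ∷ xs) f with f x | search xs f
... | inj₁ p | _      = inj₁ (x , p)
... | inj₂ q | inj₁ p = inj₁ p
... | inj₂ q | inj₂ g = inj₂ λ { (here refl) → q ; (there x∈) → g x∈ }

module HallTheorem {V : Set} (_≟_ : DecidableEquality V) (verts : List V)
  (verts-complete : ∀ v → v ∈ verts) where

  Saturating : (V → V → Set) → List V → Set
  Saturating R xs = Σ (V → V) λ m →
    (∀ {x} → x ∈ xs → R x (m x)) × (∀ {x y} → x ∈ xs → y ∈ xs → m x ≡ m y → x ≡ y)

  Violator : (V → V → Set) → List V → Set
  Violator R xs = Σ (List V) λ T → Σ (List V) λ N →
    Unique T × T ⊆ xs × (∀ {x} → x ∈ T → ∀ y → R x y → y ∈ N) × length N < length T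

  -- N ∪ {y} has at most |T| elements, so the injection m maps T onto it.
  tight : ∀ {R xs} y ((m , _) : Saturating R xs) → Violator (λ a b → R a b × b ≢ y) xs →
    ∃ λ T → T ⊆ xs × (∀ {x} → x ∈ T → ∀ b → R x b → b ∈ map m T) × y ∈ map m T
  tight y (m , sat , inj) (T , N , T! , T⊆xs , closed , N<T) =
    T , T⊆xs , (λ x∈ b r → onto (nbr x∈ b r)) , onto (here refl)
    where
    nbr : ∀ {x} → x ∈ T → ∀ b → _ → b ∈ y ∷ N
    nbr x∈ b r with b ≟ y
    ... | yes b≡y = here b≡y
    ... | no  b≢y = there (closed x∈ b (r , b≢y))

    onto : y ∷ N ⊆ map m T
    onto = Unique-tight _≟_ (map-unique m (λ p q → inj (T⊆xs p) (T⊆xs q)) T!)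
      (λ p → let x , x∈ , e = ∈-map⁻ m p in subst (_∈ y ∷ N) (sym e) (nbr x∈ _ (sat (T⊆xs x∈))))
      (≤-trans N<T (≤-reflexive (sym (length-map m T))))

  -- If removing any neighbour y of x makes xs unsaturable, the union of the resulting tight
  -- sets, together with x, violates Hall's condition.
  hall : ∀ {R : V → V → Set} → (∀ x y → Dec (R x y)) → ∀ {xs} → Unique xs →
    Saturating R xs ⊎ Violator R xs
  hall R? [] = inj₁ ((λ x → x) , (λ ()) , (λ ()))
  hall {R} R? {x ∷ xs} (x# ∷ xs!) with hall R? xs!
  ... | inj₂ (T , N , T! , T⊆xs , closed , N<T) = inj₂ (T , N , T! , there ∘ T⊆xs , closed , N<T)
  ... | inj₁ M@(m , sat , inj) with search verts attempt
    where
    Tight : V → Set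
    Tight y = ∃ λ T → T ⊆ xs × (∀ {x} → x ∈ T → ∀ b → R x b → b ∈ map m T) × (R x y → y ∈ map m T)

    attempt : ∀ y → (R x y × Saturating (λ a b → R a b × b ≢ y) xs) ⊎ Tight y
    attempt y with R? x y
    -- If `y` is not a neighbour of `x`, the empty set serves as its tight set.
    ... | no ¬r = inj₂ ([] , (λ ()) , (λ ()) , λ r → contradiction r ¬r)
    ... | yes r with hall (λ a b → R? a b ×-dec ¬? (b ≟ y)) xs!
    ...   | inj₁ s = inj₁ (r , s)
    ...   | inj₂ v = let T , T⊆xs , closed , y∈ = tight y M v in
                     inj₂ (T , T⊆xs , closed , λ _ → y∈)
  -- Since `m′` avoids `y` on `xs`, sending `x` to `y` keeps it injective.
  ... | inj₁ (y , r , m′ , sat′ , inj′) = inj₁ (m″ , sat″ , inj″)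
    where
    m″ : V → V
    m″ a with a ≟ x
    ... | yes _ = y
    ... | no  _ = m′ a

    sat″ : ∀ {a} → a ∈ x ∷ xs → R a (m″ a)
    sat″ {a} a∈ with a ≟ x | a∈
    ... | yes refl | _        = r
    ... | no a≢x   | here e   = contradiction e a≢x
    ... | no a≢x   | there a∈ = proj₁ (sat′ a∈)

    inj″ : ∀ {a b} → a ∈ x ∷ xs → b ∈ x ∷ xs → m″ a ≡ m″ b → a ≡ b
    inj″ {a} {b} a∈ b∈ e with a ≟ x | b ≟ x | a∈ | b∈
    ... | yes refl | yes refl | _        | _        = refl
    ... | yes refl | no b≢x   | _        | here p   = contradiction p b≢x
    ... | yes refl | no b≢x   | _        | there b∈ = contradiction (sym e) (proj₂ (sat′ b∈))
    ... | no a≢x   | _        | here p   | _        = contradiction p a≢x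
    ... | no a≢x   | yes refl | there a∈ | _        = contradiction e (proj₂ (sat′ a∈))
    ... | no a≢x   | no b≢x   | there a∈ | here p   = contradiction p b≢x
    ... | no a≢x   | no b≢x   | there a∈ | there b∈ = inj′ a∈ b∈ e
  -- `map m U` is as long as `U`, so `x` is the surplus element. It contains every neighbour `b` of
  -- `x` because the tight set for `b` has `b` in its image.
  ... | inj₂ tightAt = inj₂
    ( x ∷ U , map m U
    , All.¬Any⇒All¬ _ (All.All¬⇒¬Any x# ∘ U⊆xs) ∷ UniqueDec.deduplicate-! _≟_ _
    , (λ { (here e) → here e ; (there p) → there (U⊆xs p) })
    , closed , ≤-reflexive (cong suc (length-map m U)) )
    where
    part : V → List V
    part y = proj₁ (tightAt (verts-complete y))

    U : List V
    U = deduplicate _≟_ (concatMap part verts)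

    part⊆U : ∀ y → part y ⊆ U
    part⊆U y p = ∈-deduplicate⁺ _≟_ (∈-concatMap⁺ part (lose (verts-complete y) p))

    U⊆parts : ∀ {a} → a ∈ U → ∃ λ y → a ∈ part y
    U⊆parts p =
      let y , _ , q = find (∈-concatMap⁻ part {verts} (∈-deduplicate⁻ _≟_ _ p)) in y , q

    U⊆xs : U ⊆ xs
    U⊆xs p = let y , q = U⊆parts p in proj₁ (proj₂ (tightAt (verts-complete y))) q

    map-part⊆ : ∀ y → map m (part y) ⊆ map m U
    map-part⊆ y p = let a , a∈ , e = ∈-map⁻ m p in
      subst (_∈ map m U) (sym e) (∈-map⁺ m (part⊆U y a∈))

    closed : ∀ {a} → a ∈ x ∷ U → ∀ b → R a b → b ∈ map m U
    closed (here refl) b r =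
      map-part⊆ b (proj₂ (proj₂ (proj₂ (tightAt (verts-complete b)))) r)
    closed (there a∈) b r = let y , q = U⊆parts a∈ in
      map-part⊆ y (proj₁ (proj₂ (proj₂ (tightAt (verts-complete y)))) q b r)

-- Fractional perfect matchings from permutations

-- At `verts` this is `sumOver` by definition; taking the list as an argument makes induction
-- possible.
sumℚ : ∀ {A : Set} → (A → ℚ) → List A → ℚ
sumℚ g = foldr (λ v acc → g v ℚ.+ acc) 0ℚ

sumℚ-0 : ∀ {A : Set} {g : A → ℚ} {xs} → (∀ {x} → x ∈ xs → g x ≡ 0ℚ) → sumℚ g xs ≡ 0ℚ
sumℚ-0 {xs = []}     z = refl
sumℚ-0 {xs = x ∷ xs} z = cong₂ ℚ._+_ (z (here refl)) (sumℚ-0 (z ∘ there))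

sumℚ-single : ∀ {A : Set} (g : A → ℚ) {xs x} → Unique xs → x ∈ xs →
  (∀ y → y ≢ x → g y ≡ 0ℚ) → sumℚ g xs ≡ g x
sumℚ-single g (x# ∷ _) (here refl) z =
  trans (cong (g _ ℚ.+_) (sumℚ-0 λ y∈ → z _ (λ e → All.lookup x# y∈ (sym e)))) (ℚ.+-identityʳ _)
sumℚ-single g (y# ∷ xs!) (there x∈) z =
  trans (cong₂ ℚ._+_ (z _ (All.lookup y# x∈)) (sumℚ-single g xs! x∈ z)) (ℚ.+-identityˡ _)

sumℚ-+ : ∀ {A : Set} (g h : A → ℚ) xs →
  sumℚ (λ x → g x ℚ.+ h x) xs ≡ sumℚ g xs ℚ.+ sumℚ h xs
sumℚ-+ g h []       = refl
sumℚ-+ g h (x ∷ xs) = trans (cong (g x ℚ.+ h x ℚ.+_) (sumℚ-+ g h xs))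
  (interchange (g x) (h x) (sumℚ g xs) (sumℚ h xs))
  where open CommutativeSemigroup
               (CommutativeMonoid.commutativeSemigroup ℚ.+-0-commutativeMonoid)

half : ∀ {P : Set} → Dec P → ℚ
half (yes _) = ½
half (no _)  = 0ℚ

half-yes : ∀ {P : Set} (P? : Dec P) → P → half P? ≡ ½
half-yes (yes _) p = refl
half-yes (no ¬p) p = contradiction p ¬p

half-no : ∀ {P : Set} (P? : Dec P) → ¬ P → half P? ≡ 0ℚ
half-no (yes p) ¬p = contradiction p ¬p
half-no (no _)  ¬p = refl

half+half-bounds : ∀ {P Q : Set} (P? : Dec P) (Q? : Dec Q) →
  0ℚ ℚ.≤ half P? ℚ.+ half Q? × half P? ℚ.+ half Q? ℚ.≤ 1ℚ
half+half-bounds (yes _) (yes _) = from-yes (0ℚ ℚ.≤? ½ ℚ.+ ½) , from-yes (½ ℚ.+ ½ ℚ.≤? 1ℚ)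
half+half-bounds (yes _) (no _)  = from-yes (0ℚ ℚ.≤? ½ ℚ.+ 0ℚ) , from-yes (½ ℚ.+ 0ℚ ℚ.≤? 1ℚ)
half+half-bounds (no _)  (yes _) = from-yes (0ℚ ℚ.≤? 0ℚ ℚ.+ ½) , from-yes (0ℚ ℚ.+ ½ ℚ.≤? 1ℚ)
half+half-bounds (no _)  (no _)  = from-yes (0ℚ ℚ.≤? 0ℚ) , from-yes (0ℚ ℚ.≤? 1ℚ)

module Faulty (G : Graph) (F : List (Elem G)) where
  open Graph G
  open HallTheorem _≟V_ verts verts-complete public
  open DecMembership (Sum.≡-dec _≟V_ (Product.≡-dec _≟V_ _≟V_)) using () renaming (_∈?_ to _∈F?_)
  open DecMembership _≟V_ using (_∈?_)

  Live : V → V → Set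
  Live = LiveEdge G F

  alive? : ∀ v → Dec (Alive G F v)
  alive? v = ¬? (inj₁ v ∈F? F)

  live? : ∀ u v → Dec (Live u v)
  live? u v = adj? u v ×-dec alive? u ×-dec alive? v
            ×-dec ¬? (inj₂ (u , v) ∈F? F) ×-dec ¬? (inj₂ (v , u) ∈F? F)

  live-sym : ∀ {u v} → Live u v → Live v u
  live-sym (a , p , q , r , s) = adj-sym a , q , p , s , r

  aliveVerts : List V
  aliveVerts = filter alive? verts

  aliveVerts! : Unique aliveVerts
  aliveVerts! = Unique.filter⁺ alive? verts-unique

  alive⁺ : ∀ {v} → Alive G F v → v ∈ aliveVerts
  alive⁺ p = ∈-filter⁺ alive? (verts-complete _) p

  -- A saturating m permutes the vertices of G - F; every arc u → m u contributes ½ to its edge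
  -- (so a 2-cycle of m gives an edge of weight 1).
  saturating⇒fpm : Saturating Live aliveVerts → HasFracPerfectMatching G F
  saturating⇒fpm (m , sat , inj) = f
    , (λ u v → ℚ.+-comm (half (arc? u v)) (half (arc? v u)))
    , (λ u v ¬l → cong₂ ℚ._+_ (half-no (arc? u v) (¬l ∘ arc⇒live))
                            (half-no (arc? v u) (¬l ∘ live-sym ∘ arc⇒live)))
    , (λ u v _ → half+half-bounds (arc? u v) (arc? v u))
    , λ u au → trans (sumℚ-+ (half ∘ arc? u) (λ v → half (arc? v u)) verts)
                     (cong₂ ℚ._+_ (out u au) (into u au))
    where
    Arc : V → V → Set
    Arc u v = Alive G F u × m u ≡ v

    arc? : ∀ u v → Dec (Arc u v)
    arc? u v = alive? u ×-dec (m u ≟V v)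

    f : V → V → ℚ
    f u v = half (arc? u v) ℚ.+ half (arc? v u)

    arc⇒live : ∀ {u v} → Arc u v → Live u v
    arc⇒live (au , refl) = sat (alive⁺ au)

    out : ∀ u → Alive G F u → sumℚ (half ∘ arc? u) verts ≡ ½
    out u au = trans
      (sumℚ-single _ verts-unique (verts-complete (m u))
        λ v v≢ → half-no (arc? u v) (λ { (_ , e) → v≢ (sym e) }))
      (half-yes (arc? u (m u)) (au , refl))

    -- Live edges end at alive vertices, so `m` is an injection of a finite set into itself.
    surjective : aliveVerts ⊆ map m aliveVerts
    surjective = Unique-tight _≟V_ (map-unique m inj aliveVerts!)
      (λ p → let u , u∈ , e = ∈-map⁻ m p in
             subst (_∈ aliveVerts) (sym e) (alive⁺ (proj₁ (proj₂ (proj₂ (sat u∈))))))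
      (≤-reflexive (sym (length-map m aliveVerts)))

    into : ∀ u → Alive G F u → sumℚ (λ v → half (arc? v u)) verts ≡ ½
    into u au = let w , w∈ , e = ∈-map⁻ m (surjective (alive⁺ au))
                    aw = proj₂ (∈-filter⁻ alive? {xs = verts} w∈) in trans
      (sumℚ-single _ verts-unique (verts-complete w)
        λ v v≢ → half-no (arc? v u) λ { (av , e′) → v≢ (inj (alive⁺ av) w∈ (trans e′ e)) })
      (half-yes (arc? w u) (aw , sym e))

  -- Independence of `T` in G - F is contained in `closed` and `disjoint`: a live edge inside `T`
  -- would put one of its ends in `N`.
  record IndependentViolator : Set where
    field
      T N      : List V
      T-unique : Unique T
      T-alive  : ∀ {v} → v ∈ T → Alive G F v
      closed   : ∀ {u} → u ∈ T → ∀ v → Live u v → v ∈ N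
      disjoint : ∀ {v} → v ∈ T → v ∉ N
      N<T      : length N < length T

  length-filter-split : ∀ {P : V → Set} (P? : ∀ v → Dec (P v)) xs →
    length (filter P? xs) + length (filter (¬? ∘ P?) xs) ≡ length xs
  length-filter-split P? [] = refl
  length-filter-split P? (x ∷ xs) with P? x
  ... | yes _ = cong suc (length-filter-split P? xs)
  ... | no  _ = trans (+-suc _ _) (cong suc (length-filter-split P? xs))

  -- Discarding T ∩ N from both sides keeps N smaller than T, and by symmetry of Live no
  -- neighbour of a remaining vertex is discarded from N.
  independent : Violator Live aliveVerts → IndependentViolator
  independent (T , N , T! , T⊆ , closed , N<T) = record
    { T        = filter (¬? ∘ (_∈? N)) T
    ; N        = filter (¬? ∘ (_∈? T)) N
    ; T-unique = Unique.filter⁺ (¬? ∘ (_∈? N)) T!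
    ; T-alive  = λ p → proj₂ (∈-filter⁻ alive? {xs = verts} (T⊆ (proj₁ (inT p))))
    ; closed   = λ p v l → ∈-filter⁺ (¬? ∘ (_∈? T)) (closed (proj₁ (inT p)) v l)
                   (λ v∈T → proj₂ (inT p) (closed v∈T _ (live-sym l)))
    ; disjoint = λ p q → proj₂ (inT p) (proj₁ (∈-filter⁻ (¬? ∘ (_∈? T)) {xs = N} q))
    ; N<T      = +-cancelˡ-< (length (filter (_∈? N) T)) _ _ (begin-strict
        length (filter (_∈? N) T) + length (filter (¬? ∘ (_∈? T)) N)
          -- `N` may have repetitions, so the entries of `T` in `N` are only bounded by the entries
          -- of `N` in `T`.
          ≤⟨ +-mono-≤ (Unique-⊆⇒length≤ (Unique.filter⁺ (_∈? N) T!)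
               λ p → let p₁ , p₂ = ∈-filter⁻ (_∈? N) {xs = T} p in ∈-filter⁺ (_∈? T) p₂ p₁)
               ≤-refl ⟩
        length (filter (_∈? T) N) + length (filter (¬? ∘ (_∈? T)) N)
          ≡⟨ length-filter-split (_∈? T) N ⟩
        length N
          <⟨ N<T ⟩
        length T
          ≡⟨ length-filter-split (_∈? N) T ⟨
        length (filter (_∈? N) T) + length (filter (¬? ∘ (_∈? N)) T) ∎)
    }
    where
    open ≤-Reasoning
    inT : ∀ {v} → v ∈ filter (¬? ∘ (_∈? N)) T → v ∈ T × v ∉ N
    inT = ∈-filter⁻ (¬? ∘ (_∈? N)) {xs = T}

  fpm⊎violator : HasFracPerfectMatching G F ⊎ IndependentViolator
  fpm⊎violator with hall live? aliveVerts!
  ... | inj₁ s = inj₁ (saturating⇒fpm s)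
  ... | inj₂ v = inj₂ (independent v)

-- Vertex isoperimetry

-- Boolean-valued, so that the case n = 4 can be settled by evaluation. Subsets are compared
-- pointwise, whence the congruence lemmas.
Subset : ℕ → Set
Subset n = Vec Bool n → Bool

infix 4 _⊑_
_⊑_ : ∀ {n} → Subset n → Subset n → Set
T ⊑ S = ∀ v → T v ≡ true → S v ≡ true

lower upper : ∀ {n} → Subset (suc n) → Subset n
lower T v = T (false ∷ v)
upper T v = T (true ∷ v)

card : ∀ {n} → Subset n → ℕ
card {zero}  T = if T [] then 1 else 0
card {suc n} T = card (lower T) + card (upper T)

hasNbrIn : ∀ {n} → Subset n → Subset n
hasNbrIn T []      = false
hasNbrIn T (b ∷ v) =
  hasNbrIn (λ u → T (b ∷ u)) v ∨ (T (not b ∷ v) ∨ T (not b ∷ complement v))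

∂ : ∀ {n} → Subset n → Subset n
∂ T v = not (T v) ∧ hasNbrIn T v

-- AQ₁ has its own clause because its two crossing edges coincide.
inner : ∀ {n} → Subset n → ℕ
inner {zero}        T = 0
inner {suc zero}    T = if T (false ∷ []) ∧ T (true ∷ []) then 1 else 0
inner {suc (suc n)} T =
  inner (lower T) + inner (upper T)
  + (card (λ v → lower T v ∧ upper T v) + card (λ v → lower T v ∧ upper T (complement v)))

cost : ∀ {n} → Subset n → ℕ
cost T = card (∂ T) + inner T

card-mono : ∀ {n} {T S : Subset n} → T ⊑ S → card T ≤ card S
card-mono {zero} {T} {S} T⊑S with T [] | T⊑S []
... | false | _ = z≤n
... | true  | p rewrite p refl = ≤-refl
card-mono {suc n} T⊑S =
  +-mono-≤ (card-mono (T⊑S ∘ (false ∷_))) (card-mono (T⊑S ∘ (true ∷_)))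

card-cong : ∀ {n} {T S : Subset n} → T ≗ S → card T ≡ card S
card-cong {zero}  T≗S = cong (if_then 1 else 0) (T≗S [])
card-cong {suc n} T≗S =
  cong₂ _+_ (card-cong (T≗S ∘ (false ∷_))) (card-cong (T≗S ∘ (true ∷_)))

card-complement : ∀ {n} (T : Subset n) → card (T ∘ complement) ≡ card T
card-complement {zero}  T = refl
card-complement {suc n} T = trans
  (cong₂ _+_ (card-complement (upper T)) (card-complement (lower T)))
  (+-comm (card (upper T)) (card (lower T)))

∈⇒card : ∀ {n} {T : Subset n} v → T v ≡ true → 1 ≤ card T
∈⇒card {T = T} [] p rewrite p = ≤-refl
∈⇒card (false ∷ v) p = m≤n⇒m≤n+o _ (∈⇒card v p)
∈⇒card (true ∷ v)  p = m≤n⇒m≤o+n _ (∈⇒card v p)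

card≡0⇒∉ : ∀ {n} {T : Subset n} → card T ≡ 0 → ∀ v → T v ≡ false
card≡0⇒∉ {T = T} c v with T v in eq
... | false = refl
... | true  = contradiction (subst (1 ≤_) c (∈⇒card v eq)) λ ()

hasNbrIn-cong : ∀ {n} {T S : Subset n} → T ≗ S → hasNbrIn T ≗ hasNbrIn S
hasNbrIn-cong T≗S []      = refl
hasNbrIn-cong T≗S (b ∷ v) = cong₂ _∨_ (hasNbrIn-cong (T≗S ∘ (b ∷_)) v)
  (cong₂ _∨_ (T≗S _) (T≗S _))

inner-cong : ∀ {n} {T S : Subset n} → T ≗ S → inner T ≡ inner S
inner-cong {zero}        T≗S = refl
inner-cong {suc zero}    T≗S = cong (if_then 1 else 0) (cong₂ _∧_ (T≗S _) (T≗S _))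
inner-cong {suc (suc n)} T≗S =
  cong₂ _+_ (cong₂ _+_ (inner-cong (T≗S ∘ (false ∷_))) (inner-cong (T≗S ∘ (true ∷_))))
            (cong₂ _+_ (card-cong λ v → cong₂ _∧_ (T≗S (false ∷ v)) (T≗S (true ∷ v)))
                       (card-cong λ v → cong₂ _∧_ (T≗S (false ∷ v)) (T≗S (true ∷ complement v))))

cost-cong : ∀ {n} {T S : Subset n} → T ≗ S → cost T ≡ cost S
cost-cong T≗S = cong₂ _+_
  (card-cong λ v → cong₂ _∧_ (cong not (T≗S v)) (hasNbrIn-cong T≗S v)) (inner-cong T≗S)

∂-half : ∀ {n} (T : Subset (suc n)) b → ∂ (λ v → T (b ∷ v)) ⊑ (λ v → ∂ T (b ∷ v))
∂-half T b v p with T (b ∷ v) | hasNbrIn (λ u → T (b ∷ u)) v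
... | false | true = refl

∂-other : ∀ {n} (T : Subset (suc n)) b → (∀ v → T (b ∷ v) ≡ false) →
  (λ v → T (not b ∷ v) ∨ T (not b ∷ complement v)) ⊑ (λ v → ∂ T (b ∷ v))
∂-other T b empty v p rewrite empty v | p = Bool.∨-zeroʳ _

inner-halves : ∀ {n} (T : Subset (suc n)) → inner (lower T) + inner (upper T) ≤ inner T
inner-halves {zero}  T = z≤n
inner-halves {suc n} T = m≤m+n _ _

-- A boundary vertex of a half stays a boundary vertex in the whole cube, and the edges between the
-- halves can only add to `inner`.
cost-halves : ∀ {n} (T : Subset (suc n)) → cost (lower T) + cost (upper T) ≤ cost T
cost-halves T = begin
  cost (lower T) + cost (upper T)
    ≡⟨ interchange (card (∂ (lower T))) _ _ _ ⟩
  (card (∂ (lower T)) + card (∂ (upper T))) + (inner (lower T) + inner (upper T))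
    ≤⟨ +-mono-≤ (+-mono-≤ (card-mono (∂-half T false)) (card-mono (∂-half T true)))
                (inner-halves T) ⟩
  cost T ∎
  where
  open ≤-Reasoning
  open CommutativeSemigroup +-commutativeSemigroup using (interchange)

-- Every vertex of the empty half joined to `T` by a straight or crossed edge is in the boundary.
-- These vertices are the copies of `T` and of its antipodes, and they come on top of the cost
-- within the other half.
cost-one-half : ∀ {n} (T : Subset (suc n)) b → (∀ v → T (b ∷ v) ≡ false) →
  cost (λ v → T (not b ∷ v)) + card (λ v → T (not b ∷ v) ∨ T (not b ∷ complement v)) ≤ cost T
cost-one-half T false empty = begin
  (card (∂ (upper T)) + inner (upper T)) + card (λ v → upper T v ∨ upper T (complement v))
    ≡⟨ solve 3 (λ a b c → (a :+ b) :+ c := (c :+ a) :+ b) refl (card (∂ (upper T))) _ _ ⟩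
  (card (λ v → upper T v ∨ upper T (complement v)) + card (∂ (upper T))) + inner (upper T)
    ≤⟨ +-mono-≤ (+-mono-≤ (card-mono (∂-other T false empty)) (card-mono (∂-half T true)))
                (≤-trans (m≤n+m _ _) (inner-halves T)) ⟩
  cost T ∎
  where open ≤-Reasoning; open +-*-Solver
cost-one-half T true empty = begin
  (card (∂ (lower T)) + inner (lower T)) + card (λ v → lower T v ∨ lower T (complement v))
    ≡⟨ solve 3 (λ a b c → (a :+ b) :+ c := (a :+ c) :+ b) refl (card (∂ (lower T))) _ _ ⟩
  (card (∂ (lower T)) + card (λ v → lower T v ∨ lower T (complement v))) + inner (lower T)
    ≤⟨ +-mono-≤ (+-mono-≤ (card-mono (∂-half T false)) (card-mono (∂-other T true empty)))
                (≤-trans (m≤m+n _ _) (inner-halves T)) ⟩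
  cost T ∎
  where open ≤-Reasoning; open +-*-Solver

card≤antipodal : ∀ {n} (T : Subset n) → card T ≤ card (λ v → T v ∨ T (complement v))
card≤antipodal T = card-mono {T = T} λ v p → cong (_∨ T (complement v)) p

-- A vertex and its complement differ in the first bit, so the antipodal closure of a nonempty set
-- meets both halves.
antipodal-≥2 : ∀ {n} (T : Subset (suc n)) → 1 ≤ card T →
  2 ≤ card (λ v → T v ∨ T (complement v))
antipodal-≥2 {n} T 1≤c with card (lower T) in eq
... | zero  = +-mono-≤
  (≤-trans 1≤c (≤-trans (≤-reflexive (sym (card-complement (upper T))))
    (card-mono {T = upper T ∘ complement} λ v p → trans (cong (T (false ∷ v) ∨_) p) (Bool.∨-zeroʳ _))))
  (≤-trans 1≤c (card-mono {T = upper T} λ v p → cong (_∨ T (false ∷ complement v)) p))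
... | suc m = +-mono-≤
  (≤-trans 1≤l (card-mono {T = lower T} λ v p → cong (_∨ T (true ∷ complement v)) p))
  (≤-trans 1≤l (≤-trans (≤-reflexive (sym (card-complement (lower T))))
    (card-mono {T = lower T ∘ complement} λ v p → trans (cong (T (true ∷ v) ∨_) p) (Bool.∨-zeroʳ _))))
  where
  1≤l : 1 ≤ card (lower T)
  1≤l = subst (1 ≤_) (sym eq) (s≤s z≤n)

-- For n = 4 + k the constants are 2n - 2 and 2n - 1; |T| stands on the left to avoid truncated
-- subtraction.
Isoperimetric : ∀ k → Subset (4 + k) → Set
Isoperimetric k T = (1 ≤ card T → 6 + (k + k) + card T ≤ cost T)
                  × (2 ≤ card T → 7 + (k + k) + card T ≤ cost T)

-- Both constants grow by 2 with the dimension, and the boundary in the empty half supplies at least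
-- these 2.
isoperimetric-one-half : ∀ k (T : Subset (5 + k)) b → (∀ v → T (b ∷ v) ≡ false) →
  card T ≡ card (λ v → T (not b ∷ v)) →
  Isoperimetric k (λ v → T (not b ∷ v)) → Isoperimetric (suc k) T
isoperimetric-one-half k T b empty c≡ (iso₁ , iso₂) =
    (λ 1≤c → let 1≤u = subst (1 ≤_) c≡ 1≤c in
      step 6 (iso₁ 1≤u) (antipodal-≥2 U 1≤u))
  , (λ 2≤c → let 2≤u = subst (2 ≤_) c≡ 2≤c in
      step 7 (iso₂ 2≤u) (≤-trans 2≤u (card≤antipodal U)))
  where
  U : Subset (4 + k)
  U v = T (not b ∷ v)

  antipodal : ℕ
  antipodal = card (λ v → U v ∨ U (complement v))

  step : ∀ m → m + (k + k) + card U ≤ cost U → 2 ≤ antipodal →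
    m + (suc k + suc k) + card T ≤ cost T
  step m p q = begin
    m + (suc k + suc k) + card T
      ≡⟨ cong (m + (suc k + suc k) +_) c≡ ⟩
    m + (suc k + suc k) + card U
      ≡⟨ solve 3 (λ m k u → m :+ ((con 1 :+ k) :+ (con 1 :+ k)) :+ u
                         := (m :+ (k :+ k) :+ u) :+ con 2) refl m k (card U) ⟩
    (m + (k + k) + card U) + 2
      ≤⟨ +-mono-≤ p q ⟩
    cost U + antipodal
      ≤⟨ cost-one-half T b empty ⟩
    cost T ∎
    where open ≤-Reasoning; open +-*-Solver

isoperimetric-step : ∀ k (T : Subset (5 + k)) →
  Isoperimetric k (lower T) → Isoperimetric k (upper T) → Isoperimetric (suc k) T
isoperimetric-step k T isoₗ isoᵤ with card (lower T) ≟ 0 | card (upper T) ≟ 0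
... | yes l≡0 | _       = isoperimetric-one-half k T false (card≡0⇒∉ l≡0)
  (cong (_+ card (upper T)) l≡0) isoᵤ
... | no _    | yes u≡0 = isoperimetric-one-half k T true (card≡0⇒∉ u≡0)
  (trans (cong (card (lower T) +_) u≡0) (+-identityʳ _)) isoₗ
... | no l≢0  | no u≢0  = (λ _ → ≤-trans (n≤1+n _) bound) , (λ _ → bound)
  where
  open ≤-Reasoning
  l u : ℕ
  l = card (lower T)
  u = card (upper T)

  bound : 7 + (suc k + suc k) + (l + u) ≤ cost T
  bound = begin
    7 + (suc k + suc k) + (l + u)
      -- The slack when both halves are nonempty: twice the weaker constant 6 + 2k exceeds the
      -- required 9 + 2k by 3 + 2k.
      ≤⟨ m≤m+n _ (3 + (k + k)) ⟩
    7 + (suc k + suc k) + (l + u) + (3 + (k + k))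
      ≡⟨ solve 3 (λ k l u →
           con 7 :+ ((con 1 :+ k) :+ (con 1 :+ k)) :+ (l :+ u) :+ (con 3 :+ (k :+ k))
           := (con 6 :+ (k :+ k) :+ l) :+ (con 6 :+ (k :+ k) :+ u)) refl k l u ⟩
    (6 + (k + k) + l) + (6 + (k + k) + u)
      ≤⟨ +-mono-≤ (proj₁ isoₗ (n≢0⇒n>0 l≢0)) (proj₁ isoᵤ (n≢0⇒n>0 u≢0)) ⟩
    cost (lower T) + cost (upper T)
      ≤⟨ cost-halves T ⟩
    cost T ∎
    where open +-*-Solver

-- The base case: exhaustive check in dimension 4

join : ∀ {n} → Subset n → Subset n → Subset (suc n)
join T₀ T₁ (false ∷ v) = T₀ v
join T₀ T₁ (true  ∷ v) = T₁ v

every : ∀ n → (Subset n → Bool) → Bool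
every zero    P = P (λ _ → false) ∧ P (λ _ → true)
every (suc n) P = every n (λ T₀ → every n (λ T₁ → P (join T₀ T₁)))

∧-split : ∀ {a b} → a ∧ b ≡ true → a ≡ true × b ≡ true
∧-split {true} p = refl , p

-- The enumeration reaches `T` only up to `≗`, and `P` is arbitrary, so the conclusion is about a
-- representative `S`.
every-sound : ∀ n P → every n P ≡ true → ∀ T → ∃ λ S → S ≗ T × P S ≡ true
every-sound zero    P p T with T [] in eq
... | false = (λ _ → false) , (λ { [] → sym eq }) , proj₁ (∧-split p)
... | true  = (λ _ → true)  , (λ { [] → sym eq }) , proj₂ (∧-split p)
every-sound (suc n) P p T =
  let S₀ , S₀≗ , p₀ = every-sound n _ p  (lower T)
      S₁ , S₁≗ , p₁ = every-sound n _ p₀ (upper T)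
  in join S₀ S₁ , (λ { (false ∷ v) → S₀≗ v ; (true ∷ v) → S₁≗ v }) , p₁

-- The curried `P` lets a check do the work that depends on `T₀` alone before `T₁` varies.
every²-sound : ∀ n (P : Subset n → Subset n → Bool) → every n (λ T₀ → every n (P T₀)) ≡ true →
  ∀ T → ∃ λ S₀ → ∃ λ S₁ → join S₀ S₁ ≗ T × P S₀ S₁ ≡ true
every²-sound n P p T =
  let S₀ , S₀≗ , p₀ = every-sound n (λ T₀ → every n (P T₀)) p (lower T)
      S₁ , S₁≗ , p₁ = every-sound n (P S₀) p₀ (upper T)
  in S₀ , S₁ , (λ { (false ∷ v) → S₀≗ v ; (true ∷ v) → S₁≗ v }) , p₁

isoperimetricᵇ : Subset 4 → Bool
isoperimetricᵇ T =
  (card T <ᵇ 1) ∨ ((if card T <ᵇ 2 then 6 + card T else 7 + card T) ≤ᵇ cost T)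

-- Evaluating isoperimetricᵇ on all 2¹⁶ subsets is slow. The first disjunct, which by
-- superadditivity of cost implies the second, disposes of all but about a thousand of them;
-- c and x are arguments so that the values for T₀ are computed once per T₀.
check′ : ℕ → ℕ → Subset 3 → Subset 3 → Bool
check′ c x T₀ T₁ = (7 + c + card T₁ ≤ᵇ x + cost T₁) ∨ isoperimetricᵇ (join T₀ T₁)

check : Subset 3 → Subset 3 → Bool
check T₀ = check′ (card T₀) (cost T₀) T₀

checkAll : every 3 (λ T₀ → every 3 (check T₀)) ≡ true
checkAll = refl

≤ᵇ-sound : ∀ {m n} → (m ≤ᵇ n) ≡ true → m ≤ n
≤ᵇ-sound {m} {n} p = ≤ᵇ⇒≤ m n (Equivalence.from Bool.T-≡ p)

isoperimetricᵇ-sound : ∀ T → isoperimetricᵇ T ≡ true → Isoperimetric 0 T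
isoperimetricᵇ-sound T p with card T
... | zero        = (λ ()) , (λ ())
... | suc zero    = (λ _ → ≤ᵇ-sound p) , λ { (s≤s ()) }
... | suc (suc c) = (λ _ → ≤-trans (n≤1+n _) (≤ᵇ-sound p)) , λ _ → ≤ᵇ-sound p

check-sound : ∀ T₀ T₁ → check T₀ T₁ ≡ true →
  Isoperimetric 0 (join T₀ T₁)
check-sound T₀ T₁ p with 7 + card T₀ + card T₁ ≤ᵇ cost T₀ + cost T₁ in eq
... | false = isoperimetricᵇ-sound (join T₀ T₁) p
... | true  = (λ _ → ≤-trans (n≤1+n _) bound) , (λ _ → bound)
  where
  bound : 7 + card (join T₀ T₁) ≤ cost (join T₀ T₁)
  bound = ≤-trans (≤-trans (≤-reflexive (sym (+-assoc 7 (card T₀) (card T₁)))) (≤ᵇ-sound eq))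
                  (cost-halves (join T₀ T₁))

isoperimetric : ∀ k (T : Subset (4 + k)) → Isoperimetric k T
isoperimetric zero    T =
  let S₀ , S₁ , S≗T , p = every²-sound 3 check checkAll T
      iso₁ , iso₂ = check-sound S₀ S₁ p
      c≡ = card-cong S≗T
      x≡ = cost-cong S≗T
  in (λ 1≤c → subst₂ (λ c x → 6 + c ≤ x) c≡ x≡ (iso₁ (subst (1 ≤_) (sym c≡) 1≤c)))
   , (λ 2≤c → subst₂ (λ c x → 7 + c ≤ x) c≡ x≡ (iso₂ (subst (2 ≤_) (sym c≡) 2≤c)))
isoperimetric (suc k) T =
  isoperimetric-step k T (isoperimetric k (lower T)) (isoperimetric k (upper T))

-- Enumeration of the edges of AQₙ

length-filter-map : ∀ {A B : Set} {P : B → Set} (P? : ∀ b → Dec (P b)) (f : A → B) xs →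
  length (filter P? (map f xs)) ≡ length (filter (P? ∘ f) xs)
length-filter-map P? f [] = refl
length-filter-map P? f (x ∷ xs) with does (P? (f x))
... | true  = cong suc (length-filter-map P? f xs)
... | false = length-filter-map P? f xs

length-filter-++ : ∀ {A : Set} {P : A → Set} (P? : ∀ a → Dec (P a)) xs ys →
  length (filter P? (xs ++ ys)) ≡ length (filter P? xs) + length (filter P? ys)
length-filter-++ P? xs ys = trans (cong length (filter-++ P? xs ys)) (length-++ (filter P? xs))

members : ∀ {n} → Subset n → List (Vec Bool n)
members {n} T = filter (λ v → T v Bool.≟ true) (allVecs n)

-- Links the recursive count, suited to induction on the dimension, with the list needed for
-- `pigeonhole`.
card≡length : ∀ {n} (T : Subset n) → card T ≡ length (members T)
card≡length {zero} T with T []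
... | true  = refl
... | false = refl
card≡length {suc n} T = sym (trans
  (length-filter-++ inT? (map (false ∷_) (allVecs n)) (map (true ∷_) (allVecs n)))
  (cong₂ _+_
    (trans (length-filter-map inT? (false ∷_) (allVecs n)) (sym (card≡length (lower T))))
    (trans (length-filter-map inT? (true ∷_) (allVecs n)) (sym (card≡length (upper T))))))
  where
  inT? : ∀ v → Dec (T v ≡ true)
  inT? v = T v Bool.≟ true

Edge : ℕ → Set
Edge n = Vec Bool n × Vec Bool n

prefix : ∀ {n} → Bool → Edge n → Edge (suc n)
prefix b (u , v) = b ∷ u , b ∷ v

straight crossed : ∀ {n} → Vec Bool n → Edge (suc n)
straight v = false ∷ v , true ∷ v
crossed v  = false ∷ v , true ∷ complement v

-- Follows the clauses of `inner`, so that the two counts agree clause by clause. Edges between the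
-- halves are oriented from the `false` half to the `true` half.
edges : ∀ n → List (Edge n)
edges zero          = []
edges (suc zero)    = straight [] ∷ []
edges (suc (suc n)) = map (prefix false) (edges (suc n)) ++ map (prefix true) (edges (suc n))
  ++ map straight (allVecs (suc n)) ++ map crossed (allVecs (suc n))

complement≢ : ∀ {n} (v : Vec Bool (suc n)) → v ≢ complement v
complement≢ (false ∷ v) ()
complement≢ (true ∷ v) ()

complement-involutive : ∀ {n} (v : Vec Bool n) → complement (complement v) ≡ v
complement-involutive v =
  trans (sym (map-∘ not not v)) (trans (map-cong Bool.not-involutive v) (map-id v))

SameEdge : ∀ {n} → Edge n → Edge n → Set
SameEdge {n} d e = SameElem (AQ n) (inj₂ d) (inj₂ e)

SameEdge-sym : ∀ {n} {d e : Edge n} → SameEdge d e → SameEdge e d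
SameEdge-sym (inj₁ (refl , refl)) = inj₁ (refl , refl)
SameEdge-sym (inj₂ (refl , refl)) = inj₂ (refl , refl)

SameEdge-trans : ∀ {n} {c d e : Edge n} → SameEdge c d → SameEdge d e → SameEdge c e
SameEdge-trans (inj₁ (refl , refl)) s                    = s
SameEdge-trans (inj₂ (refl , refl)) (inj₁ (refl , refl)) = inj₂ (refl , refl)
SameEdge-trans (inj₂ (refl , refl)) (inj₂ (refl , refl)) = inj₁ (refl , refl)

All-map-map : ∀ {A B C : Set} {R : C → C → Set} (f : A → C) (g : B → C) xs ys →
  (∀ a b → R (f a) (g b)) → All (λ c → All (R c) (map g ys)) (map f xs)
All-map-map f g xs ys r = All.map⁺ (All.universal (λ a → All.map⁺ (All.universal (r a) ys)) xs)

All-++ : ∀ {A : Set} {R : A → A → Set} {xs ys zs : List A} →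
  All (λ x → All (R x) ys) xs → All (λ x → All (R x) zs) xs →
  All (λ x → All (R x) (ys ++ zs)) xs
All-++ p q = All.map (uncurry All.++⁺) (All.zip (p , q))

-- The first bits of the two ends separate the edges within either half from each other and from
-- those between the halves. A straight edge equal to a crossed one would make some vertex its own
-- complement.
edges-distinct : ∀ n → AllPairs (λ d e → ¬ SameEdge d e) (edges n)
edges-distinct zero       = []
edges-distinct (suc zero) = [] ∷ []
edges-distinct (suc (suc n)) =
  AllPairs.++⁺ (onPrefix false (edges-distinct (suc n)))
    (AllPairs.++⁺ (onPrefix true (edges-distinct (suc n)))
      (AllPairs.++⁺ (AllPairs.map⁺ (AllPairs.map straight# vecs!))
                    (AllPairs.map⁺ (AllPairs.map crossed# vecs!))
                    (All-map-map straight crossed vs vs straight#crossed))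
      (All-++ (All-map-map (prefix true) straight es vs
                λ _ _ → λ { (inj₁ (() , _)) ; (inj₂ (_ , ())) })
              (All-map-map (prefix true) crossed es vs
                λ _ _ → λ { (inj₁ (() , _)) ; (inj₂ (_ , ())) })))
    (All-++ (All-map-map (prefix false) (prefix true) es es
              λ _ _ → λ { (inj₁ (() , _)) ; (inj₂ (() , _)) })
      (All-++ (All-map-map (prefix false) straight es vs
                λ _ _ → λ { (inj₁ (_ , ())) ; (inj₂ (() , _)) })
              (All-map-map (prefix false) crossed es vs
                λ _ _ → λ { (inj₁ (_ , ())) ; (inj₂ (() , _)) })))
  where
  es : List (Edge (suc n))
  es = edges (suc n)
  vs : List (Vec Bool (suc n))
  vs = allVecs (suc n)
  vecs! : Unique vs
  vecs! = allVecs-unique (suc n)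

  onPrefix : ∀ b → AllPairs (λ d e → ¬ SameEdge d e) es →
    AllPairs (λ d e → ¬ SameEdge d e) (map (prefix b) es)
  onPrefix b = AllPairs.map⁺ ∘ AllPairs.map λ d#e → λ
    { (inj₁ (p , q)) → d#e (inj₁ (∷-injectiveʳ p , ∷-injectiveʳ q))
    ; (inj₂ (p , q)) → d#e (inj₂ (∷-injectiveʳ p , ∷-injectiveʳ q)) }

  straight# : ∀ {u v} → u ≢ v → ¬ SameEdge (straight u) (straight v)
  straight# u≢v (inj₁ (p , _)) = u≢v (∷-injectiveʳ p)

  crossed# : ∀ {u v} → u ≢ v → ¬ SameEdge (crossed u) (crossed v)
  crossed# u≢v (inj₁ (p , _)) = u≢v (∷-injectiveʳ p)

  straight#crossed : ∀ u v → ¬ SameEdge (straight u) (crossed v)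
  straight#crossed u .u (inj₁ (refl , e)) = complement≢ u (∷-injectiveʳ e)

edges-adjacent : ∀ n {u v} → (u , v) ∈ edges n → AQAdj u v
edges-adjacent (suc zero) (here refl) = inj₁ refl
edges-adjacent (suc (suc n)) p with ∈-++⁻ (map (prefix false) (edges (suc n))) p
... | inj₁ q with _ , e∈ , refl ← ∈-map⁻ (prefix false) q = edges-adjacent (suc n) e∈
... | inj₂ q with ∈-++⁻ (map (prefix true) (edges (suc n))) q
...   | inj₁ r with _ , e∈ , refl ← ∈-map⁻ (prefix true) r = edges-adjacent (suc n) e∈
...   | inj₂ r with ∈-++⁻ (map straight (allVecs (suc n))) r
...     | inj₁ s with _ , _ , refl ← ∈-map⁻ straight s = inj₁ refl
...     | inj₂ s with v , _ , refl ← ∈-map⁻ crossed s = inj₂ (sym (complement-involutive v))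

innerEdges : ∀ {n} → Subset n → List (Edge n)
innerEdges {n} T = filter (λ (u , v) → (T u ∧ T v) Bool.≟ true) (edges n)

inner≡length : ∀ {n} (T : Subset n) → inner T ≡ length (innerEdges T)
inner≡length {zero} T = refl
inner≡length {suc zero} T with T (false ∷ []) ∧ T (true ∷ [])
... | true  = refl
... | false = refl
inner≡length {suc (suc n)} T = sym (begin
  length (innerEdges T)
    ≡⟨ length-filter-++ inT? E₀ _ ⟩
  length (filter inT? E₀) + length (filter inT? (E₁ ++ E₂ ++ E₃))
    ≡⟨ cong₂ _+_ (length-filter-map inT? (prefix false) (edges (suc n)))
         (trans (length-filter-++ inT? E₁ _) (cong₂ _+_ (length-filter-map inT? (prefix true) (edges (suc n)))
           (trans (length-filter-++ inT? E₂ _)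
             (cong₂ _+_ (length-filter-map inT? straight vs) (length-filter-map inT? crossed vs))))) ⟩
  length (innerEdges (lower T)) + (length (innerEdges (upper T)) + (length (members S) + length (members C)))
    ≡⟨ cong₂ _+_ (sym (inner≡length (lower T))) (cong₂ _+_ (sym (inner≡length (upper T)))
         (cong₂ _+_ (sym (card≡length S)) (sym (card≡length C)))) ⟩
  inner (lower T) + (inner (upper T) + (card S + card C))
    ≡⟨ +-assoc (inner (lower T)) _ _ ⟨
  inner T ∎)
  where
  open ≡-Reasoning
  inT? : (e : Edge (suc (suc n))) → Dec ((T (proj₁ e) ∧ T (proj₂ e)) ≡ true)
  inT? (u , v) = (T u ∧ T v) Bool.≟ true
  vs = allVecs (suc n)
  E₀ = map (prefix false) (edges (suc n))
  E₁ = map (prefix true) (edges (suc n))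
  E₂ = map straight vs
  E₃ = map crossed vs
  S C : Subset (suc n)
  S v = lower T v ∧ upper T v
  C v = lower T v ∧ upper T (complement v)

hasNbrIn-sound : ∀ {n} (T : Subset n) v → hasNbrIn T v ≡ true → ∃ λ u → T u ≡ true × AQAdj v u
hasNbrIn-sound T (b ∷ v) p with hasNbrIn (λ u → T (b ∷ u)) v in e₁
hasNbrIn-sound T (false ∷ v) p | true =
  let u , u∈ , a = hasNbrIn-sound _ v e₁ in false ∷ u , u∈ , a
hasNbrIn-sound T (true ∷ v) p | true =
  let u , u∈ , a = hasNbrIn-sound _ v e₁ in true ∷ u , u∈ , a
... | false with T (not b ∷ v) in e₂
hasNbrIn-sound T (false ∷ v) p | false | true  = true ∷ v , e₂ , inj₁ refl
hasNbrIn-sound T (true ∷ v)  p | false | true  = false ∷ v , e₂ , inj₁ refl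
hasNbrIn-sound T (false ∷ v) p | false | false =
  true ∷ complement v , p , inj₂ (sym (complement-involutive v))
hasNbrIn-sound T (true ∷ v)  p | false | false =
  false ∷ complement v , p , inj₂ (sym (complement-involutive v))

∂-sound : ∀ {n} (T : Subset n) v → ∂ T v ≡ true →
  T v ≡ false × ∃ λ u → T u ≡ true × AQAdj v u
∂-sound T v p with T v
... | false = refl , hasNbrIn-sound T v p

-- From violators to faults

module Counting {n} (F : List (Elem (AQ n))) (I : Faulty.IndependentViolator (AQ n) F) where
  open Graph (AQ n) using (_≟V_)
  open Faulty.IndependentViolator I
  open DecMembership _≟V_ using (_∈?_)
  open DecMembership (Sum.≡-dec _≟V_ (Product.≡-dec _≟V_ _≟V_)) using () renaming (_∈?_ to _∈F?_)

  T∋ : Subset n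
  T∋ v = does (v ∈? T)

  T∋⇒∈ : ∀ {v} → T∋ v ≡ true → v ∈ T
  T∋⇒∈ {v} p with yes v∈T ← v ∈? T = v∈T

  length≤card : length T ≤ card T∋
  length≤card = subst (length T ≤_) (sym (card≡length T∋))
    (Unique-⊆⇒length≤ T-unique λ {v} v∈T →
      ∈-filter⁺ (λ v → T∋ v Bool.≟ true) (allVecs-complete n v) (dec-true (v ∈? T) v∈T))

  -- As `u` is alive, either the edge is live and `closed` applies, or the fault is `v` or the edge
  -- in one of its orientations.
  adjacent-closed : ∀ {u v} → u ∈ T → AQAdj u v →
    v ∈ N ⊎ ∃ λ x → x ∈ F × (x ≡ inj₁ v ⊎ x ≡ inj₂ (u , v) ⊎ x ≡ inj₂ (v , u))
  adjacent-closed {u} {v} u∈T a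
    with inj₁ v ∈F? F | inj₂ (u , v) ∈F? F | inj₂ (v , u) ∈F? F
  ... | yes p | _     | _     = inj₂ (_ , p , inj₁ refl)
  ... | no _  | yes p | _     = inj₂ (_ , p , inj₂ (inj₁ refl))
  ... | no _  | no _  | yes p = inj₂ (_ , p , inj₂ (inj₂ refl))
  ... | no p  | no q  | no r  = inj₁ (closed u∈T v (a , T-alive u∈T , p , q , r))

  -- Has length `cost T∋`; each entry is to be charged to an entry of `F ++ map inj₁ N` of its own.
  demands : List (Elem (AQ n))
  demands = map inj₁ (members (∂ T∋)) ++ map inj₂ (innerEdges T∋)

  -- A vertex of N counts here as a deleted vertex.
  Meets : Elem (AQ n) → Elem (AQ n) → Set
  Meets (inj₁ w)       (inj₁ v)       = w ≡ v
  Meets (inj₁ w)       (inj₂ (u , v)) = T∋ w ≡ false × (w ≡ u × T∋ v ≡ true ⊎ w ≡ v × T∋ u ≡ true)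
  Meets (inj₂ (a , b)) x              =
    T∋ a ≡ true × T∋ b ≡ true × SameElem (AQ n) (inj₂ (a , b)) x

  -- An edge meets a boundary vertex only as its end outside `T`, the other end being in `T`; so it
  -- meets at most one.
  boundary# : ∀ {w w′} → w ≢ w′ → ∀ x → Meets (inj₁ w) x → ¬ Meets (inj₁ w′) x
  boundary# w≢ (inj₁ v) p q = w≢ (trans p (sym q))
  boundary# w≢ (inj₂ (u , v)) (_ , inj₁ (refl , _)) (_ , inj₁ (refl , _)) = w≢ refl
  boundary# w≢ (inj₂ (u , v)) (w∉ , inj₁ (refl , _)) (_ , inj₂ (refl , u∈)) = Bool.not-¬ w∉ u∈
  boundary# w≢ (inj₂ (u , v)) (w∉ , inj₂ (refl , _)) (_ , inj₁ (refl , v∈)) = Bool.not-¬ w∉ v∈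
  boundary# w≢ (inj₂ (u , v)) (_ , inj₂ (refl , _)) (_ , inj₂ (refl , _)) = w≢ refl

  inner# : ∀ {d e} → ¬ SameEdge d e → ∀ x → Meets (inj₂ d) x → ¬ Meets (inj₂ e) x
  inner# d#e (inj₂ y) (_ , _ , s) (_ , _ , t) = d#e (SameEdge-trans s (SameEdge-sym t))

  boundary#inner : ∀ w e x → Meets (inj₁ w) x → ¬ Meets (inj₂ e) x
  boundary#inner w _ (inj₂ _) (w∉ , inj₁ (refl , _)) (a∈ , b∈ , inj₁ (refl , refl)) = Bool.not-¬ w∉ a∈
  boundary#inner w _ (inj₂ _) (w∉ , inj₁ (refl , _)) (a∈ , b∈ , inj₂ (refl , refl)) = Bool.not-¬ w∉ b∈
  boundary#inner w _ (inj₂ _) (w∉ , inj₂ (refl , _)) (a∈ , b∈ , inj₁ (refl , refl)) = Bool.not-¬ w∉ b∈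
  boundary#inner w _ (inj₂ _) (w∉ , inj₂ (refl , _)) (a∈ , b∈ , inj₂ (refl , refl)) = Bool.not-¬ w∉ a∈

  cost≤faults : cost T∋ ≤ length F + length N
  cost≤faults = begin
    card (∂ T∋) + inner T∋
      ≡⟨ cong₂ _+_ (card≡length (∂ T∋)) (inner≡length T∋) ⟩
    length (members (∂ T∋)) + length (innerEdges T∋)
      ≡⟨ cong₂ _+_ (length-map inj₁ (members (∂ T∋))) (length-map inj₂ (innerEdges T∋)) ⟨
    length (map inj₁ (members (∂ T∋))) + length (map inj₂ (innerEdges T∋))
      ≡⟨ length-++ (map inj₁ (members (∂ T∋))) ⟨
    length demands
      ≤⟨ pigeonhole Meets exclusive met ⟩
    length (F ++ map inj₁ N)
      ≡⟨ trans (length-++ F) (cong (length F +_) (length-map inj₁ N)) ⟩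
    length F + length N ∎
    where
    open ≤-Reasoning

    exclusive : AllPairs (λ d e → ∀ x → Meets d x → ¬ Meets e x) demands
    exclusive = AllPairs.++⁺
      (AllPairs.map⁺ (AllPairs.map boundary#
        (Unique.filter⁺ (λ v → ∂ T∋ v Bool.≟ true) (allVecs-unique n))))
      (AllPairs.map⁺ (AllPairs.map inner#
        (AllPairs.filter⁺ (λ (u , v) → (T∋ u ∧ T∋ v) Bool.≟ true) (edges-distinct n))))
      (All-map-map inj₁ inj₂ (members (∂ T∋)) (innerEdges T∋) boundary#inner)

    met : ∀ {d} → d ∈ demands → ∃ λ x → x ∈ F ++ map inj₁ N × Meets d x
    met d∈ with ∈-++⁻ (map inj₁ (members (∂ T∋))) d∈
    ... | inj₁ p with w , w∈ , refl ← ∈-map⁻ inj₁ p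
                 with _ , ∂w ← ∈-filter⁻ (λ v → ∂ T∋ v Bool.≟ true) {xs = allVecs n} w∈
                 with w∉ , u , u∈ , a ← ∂-sound T∋ w ∂w
                 with adjacent-closed (T∋⇒∈ u∈) (AQAdj-sym {u = w} a)
    ...   | inj₁ w∈N = inj₁ w , ∈-++⁺ʳ F (∈-map⁺ inj₁ w∈N) , refl
    ...   | inj₂ (x , x∈ , inj₁ refl)        = x , ∈-++⁺ˡ x∈ , refl
    ...   | inj₂ (x , x∈ , inj₂ (inj₁ refl)) = x , ∈-++⁺ˡ x∈ , w∉ , inj₂ (refl , u∈)
    ...   | inj₂ (x , x∈ , inj₂ (inj₂ refl)) = x , ∈-++⁺ˡ x∈ , w∉ , inj₁ (refl , u∈)
    met d∈ | inj₂ p with (a , b) , e∈ , refl ← ∈-map⁻ inj₂ p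
                    with e∈′ , ab ← ∈-filter⁻ (λ (u , v) → (T∋ u ∧ T∋ v) Bool.≟ true) {xs = edges n} e∈
                    with a∈ , b∈ ← ∧-split ab
                    with adjacent-closed (T∋⇒∈ a∈) (edges-adjacent n e∈′)
    -- Both ends lie in `T`, so `b` is alive and outside `N`; only the edge itself can be the fault.
    ...   | inj₁ b∈N = contradiction b∈N (disjoint (T∋⇒∈ b∈))
    ...   | inj₂ (x , x∈ , inj₁ refl)        = contradiction x∈ (T-alive (T∋⇒∈ b∈))
    ...   | inj₂ (x , x∈ , inj₂ (inj₁ refl)) = x , ∈-++⁺ˡ x∈ , a∈ , b∈ , inj₁ (refl , refl)
    ...   | inj₂ (x , x∈ , inj₂ (inj₂ refl)) = x , ∈-++⁺ˡ x∈ , a∈ , b∈ , inj₂ (refl , refl)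

nonempty : ∀ {A : Set} {xs : List A} → 0 < length xs → ∃ (_∈ xs)
nonempty {xs = x ∷ xs} _ = x , here refl

-- Here 7 + 2k is the degree. If |T| ≥ 2, the stronger isoperimetric bound forces one fault more
-- than that; so with at most 7 + 2k faults `T` is a single vertex.
enough-faults : ∀ k (F : List (Elem (AQ (4 + k)))) → ¬ HasFracPerfectMatching (AQ (4 + k)) F →
  7 + (k + k) ≤ length F × (length F ≤ 7 + (k + k) → HasIsolatedVertex (AQ (4 + k)) F)
enough-faults k F ¬fpm with Faulty.fpm⊎violator (AQ (4 + k)) F
... | inj₁ fpm = contradiction fpm ¬fpm
... | inj₂ I   = cases (2 ≤? length T)
  where
  open Faulty.IndependentViolator I
  open Counting F I using (T∋; length≤card; cost≤faults)

  -- The `suc` comes from the strict inequality |N| < |T|.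
  bound : ∀ m → m + (k + k) + card T∋ ≤ cost T∋ → suc (m + (k + k)) ≤ length F
  bound m p = +-cancelʳ-≤ (length N) _ _ (begin
    suc (m + (k + k)) + length N   ≡⟨ +-suc (m + (k + k)) (length N) ⟨
    m + (k + k) + suc (length N)   ≤⟨ +-monoʳ-≤ (m + (k + k)) (≤-trans N<T length≤card) ⟩
    m + (k + k) + card T∋          ≤⟨ p ⟩
    cost T∋                        ≤⟨ cost≤faults ⟩
    length F + length N            ∎)
    where open ≤-Reasoning

  1≤T : 1 ≤ length T
  1≤T = ≤-trans (s≤s z≤n) N<T

  cases : Dec (2 ≤ length T) →
    7 + (k + k) ≤ length F × (length F ≤ 7 + (k + k) → HasIsolatedVertex (AQ (4 + k)) F)
  cases (yes 2≤T) =
    let 8≤F = bound 7 (proj₂ (isoperimetric k T∋) (≤-trans 2≤T length≤card))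
    in ≤-trans (n≤1+n _) 8≤F , λ F≤7 → contradiction (≤-trans 8≤F F≤7) 1+n≰n
  cases (no 2≰T) =
    let v , v∈T = nonempty 1≤T
    in bound 6 (proj₁ (isoperimetric k T∋) (≤-trans 1≤T length≤card))
     -- A live neighbour of `v` would lie in `N`, so that 1 ≤ |N| < |T|, contrary to |T| < 2.
     , λ _ → v , T-alive v∈T , λ u l →
         contradiction (≤-trans (s≤s (∈-length (closed v∈T u l))) N<T) 2≰T

-- Degrees and neighbourhoods

-- The solutions are `v` and its complement, distinct in positive dimension. An arbitrary `P?`
-- covers the restriction of `AQAdj?` to either pair of opposite first bits.
two-crossings : ∀ {n} (v : Vec Bool (suc n)) (P? : ∀ u → Dec (v ≡ u ⊎ v ≡ complement u)) →
  length (filter P? (allVecs (suc n))) ≡ 2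
two-crossings {n} v P? = ≤-antisym
  (Unique-⊆⇒length≤ {ys = v ∷ complement v ∷ []} (Unique.filter⁺ P? (allVecs-unique (suc n)))
    λ {u} p → to u (proj₂ (∈-filter⁻ P? {xs = allVecs (suc n)} p)))
  (Unique-⊆⇒length≤ ((complement≢ v ∷ []) ∷ [] ∷ []) λ
    { (here refl)         → ∈-filter⁺ P? (allVecs-complete _ _) (inj₁ refl)
    ; (there (here refl)) →
        ∈-filter⁺ P? (allVecs-complete _ _) (inj₂ (sym (complement-involutive v))) })
  where
  to : ∀ u → v ≡ u ⊎ v ≡ complement u → u ∈ v ∷ complement v ∷ []
  to u (inj₁ e) = here (sym e)
  to u (inj₂ e) = there (here (trans (sym (complement-involutive u)) (cong complement (sym e))))

degree-AQ : ∀ n v → degree (AQ (suc n)) v ≡ suc (n + n)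
degree-AQ zero    (false ∷ []) = refl
degree-AQ zero    (true  ∷ []) = refl
degree-AQ (suc n) (false ∷ v)  = begin
  degree (AQ (2 + n)) (false ∷ v)
    ≡⟨ length-filter-++ P? (map (false ∷_) vs) (map (true ∷_) vs) ⟩
  length (filter P? (map (false ∷_) vs)) + length (filter P? (map (true ∷_) vs))
    ≡⟨ cong₂ _+_ (length-filter-map P? (false ∷_) vs) (length-filter-map P? (true ∷_) vs) ⟩
  degree (AQ (suc n)) v + length (filter (P? ∘ (true ∷_)) vs)
    ≡⟨ cong₂ _+_ (degree-AQ n v) (two-crossings v (P? ∘ (true ∷_))) ⟩
  suc (n + n) + 2
    ≡⟨ +-comm (suc (n + n)) 2 ⟩
  suc (suc (suc (n + n)))
    ≡⟨ cong (suc ∘ suc) (+-suc n n) ⟨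
  suc (suc n + suc n) ∎
  where
  open ≡-Reasoning
  vs : List (Vec Bool (suc n))
  vs = allVecs (suc n)
  P? : ∀ u → Dec (AQAdj (false ∷ v) u)
  P? = AQAdj? (false ∷ v)
degree-AQ (suc n) (true ∷ v)   = begin
  degree (AQ (2 + n)) (true ∷ v)
    ≡⟨ length-filter-++ P? (map (false ∷_) vs) (map (true ∷_) vs) ⟩
  length (filter P? (map (false ∷_) vs)) + length (filter P? (map (true ∷_) vs))
    ≡⟨ cong₂ _+_ (length-filter-map P? (false ∷_) vs) (length-filter-map P? (true ∷_) vs) ⟩
  length (filter (P? ∘ (false ∷_)) vs) + degree (AQ (suc n)) v
    ≡⟨ cong₂ _+_ (two-crossings v (P? ∘ (false ∷_))) (degree-AQ n v) ⟩
  suc (suc (suc (n + n)))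
    ≡⟨ cong (suc ∘ suc) (+-suc n n) ⟨
  suc (suc n + suc n) ∎
  where
  open ≡-Reasoning
  vs : List (Vec Bool (suc n))
  vs = allVecs (suc n)
  P? : ∀ u → Dec (AQAdj (true ∷ v) u)
  P? = AQAdj? (true ∷ v)

-- The membership excludes the empty list, for which `minList` defaults to 0.
minList-constant : ∀ (G : Graph) {d x xs} → x ∈ xs → All (_≡ d) xs → minList G xs ≡ d
minList-constant G {xs = y ∷ ys} _ (p ∷ ps) = go ys ps
  where
  go : ∀ zs → All (_≡ _) zs → foldr _⊓_ y zs ≡ _
  go []       []       = p
  go (z ∷ zs) (q ∷ qs) = trans (cong₂ _⊓_ q (go zs qs)) (⊓-idem _)

degree-AQ₄₊ : ∀ k v → degree (AQ (4 + k)) v ≡ 7 + (k + k)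
degree-AQ₄₊ k v = trans (degree-AQ (3 + k) v) (eq k)
  where
  open +-*-Solver
  eq : ∀ k → suc ((3 + k) + (3 + k)) ≡ 7 + (k + k)
  eq = solve 1 (λ k → con 1 :+ ((con 3 :+ k) :+ (con 3 :+ k)) := con 7 :+ (k :+ k)) refl

δ-AQ : ∀ k → δ (AQ (4 + k)) ≡ 7 + (k + k)
δ-AQ k = minList-constant (AQ (4 + k))
  (∈-map⁺ (degree (AQ (4 + k))) (allVecs-complete _ (replicate _ false)))
  (All.map⁺ (All.universal (degree-AQ₄₊ k) _))

neighbourhood : (G : Graph) → Graph.V G → List (Elem G)
neighbourhood G v = map inj₁ (filter (Graph.adj? G v) (Graph.verts G))

-- `v` survives without live edges, so the values at `v` would sum to 0 instead of 1.
neighbourhood-FSMP : ∀ G v → IsFSMPSet G (neighbourhood G v)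
neighbourhood-FSMP G v =
    ( All.map⁺ (All.universal _ _)
    , AllPairs.map⁺ (Unique.filter⁺ (adj? v) verts-unique) )
  , λ (f , _ , dead , _ , sums) →
      contradiction (trans (sym (sumℚ-0 {xs = verts} λ {u} _ → dead v u (no-live u))) (sums v alive))
        λ ()
  where
  open Graph G
  nbrs : List (Elem G)
  nbrs = neighbourhood G v

  no-live : ∀ u → ¬ LiveEdge G nbrs v u
  no-live u (a , _ , au , _) = au (∈-map⁺ inj₁ (∈-filter⁺ (adj? v) (verts-complete u) a))

  alive : Alive G nbrs v
  alive p with _ , v∈ , refl ← ∈-map⁻ inj₁ p =
    adj-irrefl (proj₂ (∈-filter⁻ (adj? v) {xs = verts} v∈))

superMatched : ∀ k → FracStronglySuperMatched (AQ (4 + k))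
superMatched k = subst FsmpSuper (sym (δ-AQ k))
  ( ( (neighbourhood (AQ (4 + k)) v₀ , neighbourhood-FSMP (AQ (4 + k)) v₀ , nbrs≡)
    , λ F (_ , ¬fpm) → proj₁ (enough-faults k F ¬fpm) )
  , λ F (_ , ¬fpm) len → proj₂ (enough-faults k F ¬fpm) (≤-reflexive len) )
  where
  -- Abstracts the number δ, so that `subst` can replace it by its value.
  FsmpSuper : ℕ → Set
  FsmpSuper d = FsmpIs (AQ (4 + k)) d
    × (∀ F → IsFSMPSet (AQ (4 + k)) F → length F ≡ d → HasIsolatedVertex (AQ (4 + k)) F)
  v₀ : Vec Bool (4 + k)
  v₀ = replicate _ false
  nbrs≡ : length (neighbourhood (AQ (4 + k)) v₀) ≡ 7 + (k + k)
  nbrs≡ = trans (length-map inj₁ (filter (AQAdj? v₀) (allVecs (4 + k)))) (degree-AQ₄₊ k v₀)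

theorem3p9 : (n : ℕ) → 4 ≤ n →
    FracStronglyMaximallyMatched (AQ n) × FracStronglySuperMatched (AQ n)
theorem3p9 n 4≤n with k , refl ← m≤n⇒∃[o]m+o≡n 4≤n =
  proj₁ (superMatched k) , superMatched k
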